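{- Let $D_5$ be the undirected tree with vertices $v,a,b,c,d$ and edges $va, vb, vc, cd$. Let $\Gamma$ be a vertex-transitive connected undirected graph with more than five vertices that contains a subgraph isomorphic to $D_5$, and suppose $\Upsilon_v(D_5,\Gamma)$ is finite. Then $\Upsilon_v^{\mathrm{sym}}(D_5,\Gamma)<5\,\Upsilon_v(D_5,\Gamma)$. In particular, $D_5$ is not vertex-costly in the class of vertex-transitive connected graphs.
   Context: Undirected graphs (loops and multiple edges may be present in $\Gamma$). "Subgraph" means an arbitrary (not necessarily induced) subgraph. A graph is vertex-transitive if its automorphism group acts transitively on its vertices. $\Upsilon_v(K,\Gamma)$ is the minimal integer $n$ such that $\Gamma$ has a set $X$ of $n$ vertices with every subgraph of $\Gamma$ isomorphic to $K$ containing a vertex of $X$; $\Upsilon_v^{\mathrm{sym}}(K,\Gamma)$ is the minimal such $n$ when $X$ is additionally required to be $\mathrm{Aut}\,\Gamma$-invariant. A finite graph $K$ with $k$ vertices is vertex-costly in a class $\mathcal{K}$ if for every integer $m$ there exists $\Gamma_m\in\mathcal{K}$ with $\Upsilon_v^{\mathrm{sym}}(K,\Gamma_m)=k\cdot\Upsilon_v(K,\Gamma_m)\ge m$. -}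

module Defs where

open import Data.Fin.Base using (Fin)
open import Data.Fin.Patterns using (0F; 1F; 2F; 3F; 4F)
open import Data.Integer.Base using (ℤ; +_) renaming (_≤_ to _≤ℤ_)
open import Data.List.Base using (List; length)
open import Data.List.Membership.Propositional using (_∈_)
open import Data.List.Relation.Unary.Unique.Propositional using (Unique)
open import Data.Nat.Base using (ℕ; _≤_; _<_; _*_)
open import Data.Product.Base using (Σ; ∃; ∃₂; ∃-syntax; _×_; _,_; proj₁; proj₂; map; swap)
open import Data.Sum.Base using (_⊎_)
open import Data.Vec.Base using (_∷_; []; lookup)
open import Function.Bundles using (_↔_; Inverse)
open import Function.Construct.Identity using (↔-id)
open import Level using (Level; _⊔_; 0ℓ) renaming (suc to lsuc)
open import Relation.Binary.Construct.Closure.ReflexiveTransitive using (Star)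
open import Relation.Binary.PropositionalEquality.Core using (_≡_)
open import Relation.Unary using (Pred; Irrelevant)

private
  variable
    v e v′ e′ ℓ : Level

-- Undirected graphs, possibly infinite, with loops and multiple edges.  The
-- order in which an edge lists its two ends carries no meaning: every notion
-- below refers to ends only through _≈ₑ_.

record Graph v e : Set (lsuc (v ⊔ e)) where
  field
    V    : Set v
    E    : Set e
    ends : E → V × V

open Graph public

_≈ₑ_ : {A : Set v} → A × A → A × A → Set v
p ≈ₑ q = p ≡ q ⊎ p ≡ swap q

Adjacent : (Γ : Graph v e) → V Γ → V Γ → Set (v ⊔ e)
Adjacent Γ x y = ∃[ f ] ends Γ f ≈ₑ (x , y)

Connected : Graph v e → Set (v ⊔ e)
Connected Γ = ∀ x y → Star (Adjacent Γ) x y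

record _≅_ (G : Graph v e) (H : Graph v′ e′) : Set (v ⊔ e ⊔ v′ ⊔ e′) where
  field
    onV  : V G ↔ V H
    onE  : E G ↔ E H

  applyV : V G → V H
  applyV = Inverse.to onV

  applyE : E G → E H
  applyE = Inverse.to onE

  field
    preserves-ends : ∀ f → ends H (applyE f) ≈ₑ map applyV applyV (ends G f)

Aut : Graph v e → Set (v ⊔ e)
Aut Γ = Γ ≅ Γ

VertexTransitive : Graph v e → Set (v ⊔ e)
VertexTransitive Γ = ∀ x y → ∃[ φ ] _≅_.applyV {G = Γ} {H = Γ} φ x ≡ y

-- Irrelevance of the two predicates ensures that the Σ-types in ⟦_⟧ do not
-- duplicate vertices or edges.

record Subgraph (Γ : Graph v e) : Set (lsuc (v ⊔ e)) where
  field
    InV            : Pred (V Γ) v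
    InE            : Pred (E Γ) e
    InV-irrelevant : Irrelevant InV
    InE-irrelevant : Irrelevant InE
    closed         : ∀ {f} → InE f → InV (proj₁ (ends Γ f)) × InV (proj₂ (ends Γ f))

  ⟦_⟧ : Graph v e
  ⟦_⟧ = record
    { V    = Σ (V Γ) InV
    ; E    = Σ (E Γ) InE
    ; ends = λ (f , f∈) → (proj₁ (ends Γ f) , proj₁ (closed f∈))
                        , (proj₂ (ends Γ f) , proj₂ (closed f∈))
    }

open Subgraph public

Contains : Graph v e → Graph v′ e′ → Set (lsuc (v ⊔ e) ⊔ v′ ⊔ e′)
Contains Γ K = ∃[ S ] ⟦_⟧ {Γ = Γ} S ≅ K

-- A finite set of vertices is represented by a duplicate-free list, so that
-- its cardinality is the length of the list.

HasMoreVerticesThan : ℕ → Graph v e → Set v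
HasMoreVerticesThan n Γ = ∃[ X ] Unique {A = V Γ} X × n < length X

Meets : (Γ : Graph v e) → Graph v′ e′ → List (V Γ) → Set (lsuc (v ⊔ e) ⊔ v′ ⊔ e′)
Meets Γ K X = (S : Subgraph Γ) → ⟦ S ⟧ ≅ K → ∃[ x ] x ∈ X × InV S x

AutInvariant : (Γ : Graph v e) → List (V Γ) → Set (v ⊔ e)
AutInvariant Γ X = (φ : Aut Γ) → ∀ {x} → x ∈ X → _≅_.applyV φ x ∈ X

IsMinimum : Pred ℕ ℓ → Pred ℕ ℓ
IsMinimum P n = P n × (∀ {m} → P m → n ≤ m)

-- Υᵥ and Υᵥˢʸᵐ are given by their graphs as partial functions: for an infinite Γ
-- there may be no finite set of the required kind.

Υᵥ[_,_]≡_ : Graph v′ e′ → Graph v e → ℕ → Set (lsuc (v ⊔ e) ⊔ v′ ⊔ e′)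
Υᵥ[ K , Γ ]≡ n = IsMinimum (λ m → ∃[ X ] Unique X × length X ≡ m × Meets Γ K X) n

Υᵥˢʸᵐ[_,_]≡_ : Graph v′ e′ → Graph v e → ℕ → Set (lsuc (v ⊔ e) ⊔ v′ ⊔ e′)
Υᵥˢʸᵐ[ K , Γ ]≡ n =
  IsMinimum (λ m → ∃[ X ] Unique X × length X ≡ m × Meets Γ K X × AutInvariant Γ X) n

record Finite (K : Graph v e) : Set (v ⊔ e) where
  field
    #V  : ℕ
    #E  : ℕ
    V↔Fin : V K ↔ Fin #V
    E↔Fin : E K ↔ Fin #E

open Finite public

VertexCostly : (K : Graph v′ e′) → Finite K → Pred (Graph v e) ℓ →
               Set (lsuc (v ⊔ e) ⊔ v′ ⊔ e′ ⊔ ℓ)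
VertexCostly K K-finite 𝒦 =
  (m : ℤ) → ∃[ Γ ] 𝒦 Γ × ∃₂ λ s n →
    Υᵥˢʸᵐ[ K , Γ ]≡ s × Υᵥ[ K , Γ ]≡ n × s ≡ #V K-finite * n × m ≤ℤ + s

D₅ : Graph 0ℓ 0ℓ
D₅ = record
  { V    = Fin 5
  ; E    = Fin 4
  ; ends = lookup ((v₀ , a) ∷ (v₀ , b) ∷ (v₀ , c) ∷ (c , d) ∷ [])
  }
  where
  v₀ a b c d : Fin 5
  v₀ = 0F
  a  = 1F
  b  = 2F
  c  = 3F
  d  = 4F

D₅-finite : Finite D₅
D₅-finite = record { #V = 5 ; #E = 4 ; V↔Fin = ↔-id _ ; E↔Fin = ↔-id _ }

{-# OPTIONS --safe #-}
module Submission where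

-- An Aut-invariant set of vertices is empty or everything.  If Γ were infinite,
-- a fork (copy of D₅) could be found outside any finite set: greedily if degrees
-- are infinite, far away from the set otherwise.  So Γ is finite and the
-- symmetric minimum is |V|.  Suppose X meets all forks and 5|X| ≤ |V|.  By
-- transitivity every vertex lies on the same number of forks, and double
-- counting shows that every fork meets X exactly once.  Move the tip d of a fork
-- (v; a, b; c, d) into X.  Comparing this fork with its variants bounds the
-- neighbourhoods: N(c) ⊆ {v,a,b,d}, N(v) ⊆ {a,b,c,d}, and c is adjacent to a or b,
-- say a, whence N(a) ⊆ {v,b,c,d}.  If c is also adjacent to b, then the fork spans
-- a component K₅.  Otherwise Γ is cubic, and exactly one of c and v is the
-- middle of a diamond, against transitivity.

open import Defs
open import Axiom.ExcludedMiddle using (ExcludedMiddle)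
open import Data.Empty using (⊥; ⊥-elim)
open import Data.Fin.Base using (Fin; zero; suc)
open import Data.Fin.Patterns using (0F; 1F; 2F; 3F)
import Data.Fin.Properties as Fin
import Data.Integer.Base as ℤ
open import Data.List.Base
  using (List; []; _∷_; _++_; length; lookup; map; filter; concatMap; deduplicate;
         cartesianProductWith; tabulate)
import Data.List.Membership.DecPropositional as DecMembership
open import Data.List.Membership.Propositional using (_∈_; _∉_; find; lose)
open import Data.List.Membership.Propositional.Properties
  using (∈-lookup; ∈-length; ∈-map⁺; ∈-map⁻; ∈-filter⁺; ∈-filter⁻; ∈-++⁺ˡ; ∈-++⁺ʳ; ∈-concatMap⁺;
         ∈-deduplicate⁺; ∈-cartesianProductWith⁺)
open import Data.List.Properties using (length-map; ∷-injective; map-injective)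
open import Data.List.Relation.Binary.Subset.Propositional using (_⊆_)
open import Data.List.Relation.Unary.All as All using (All; []; _∷_)
open import Data.List.Relation.Unary.All.Properties using (¬Any⇒All¬; All¬⇒¬Any)
open import Data.List.Relation.Unary.AllPairs using ([]; _∷_)
open import Data.List.Relation.Unary.Any as Any using (Any; here; there)
open import Data.List.Relation.Unary.Any.Properties using (lookup-index)
open import Data.List.Relation.Unary.Unique.DecPropositional.Properties using (deduplicate-!)
open import Data.List.Relation.Unary.Unique.Propositional using (Unique)
open import Data.List.Relation.Unary.Unique.Propositional.Properties
  using (map⁺; filter⁺; tabulate⁺; cartesianProductWith⁺)
open import Data.Nat.Base using (ℕ; zero; suc; _+_; _*_; _≤_; _<_; z≤n; s≤s; NonZero; >-nonZero)
open import Data.Nat.ListAction using (sum)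
open import Data.Nat.Properties
  using (≤-antisym; ≤-trans; <-irrefl; <⇒≱; ≤⇒≯; ≰⇒>; +-mono-≤; *-comm; *-assoc; *-monoˡ-<;
         *-monoˡ-≤; +-commutativeSemigroup; module ≤-Reasoning)
open import Algebra.Properties.CommutativeSemigroup +-commutativeSemigroup using (x∙yz≈y∙xz)
open import Data.Product.Base
  using (Σ; Σ-syntax; ∃-syntax; _×_; _,_; proj₁; proj₂; swap) renaming (map to map×)
open import Data.Product.Properties using (≡-dec)
open import Data.Sum.Base using (inj₁; inj₂)
open import Function.Base using (_∘_)
open import Function.Bundles using (Injection; Inverse; mk↔ₛ′)
open import Function.Definitions using (Injective)
open import Function.Properties.Inverse using (↔⇒↣; ↔-sym)
open import Level using (Level; _⊔_; 0ℓ; Lift; lift; lower)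
open import Relation.Binary.Construct.Closure.ReflexiveTransitive using (Star; ε; _◅_)
open import Relation.Binary.Core using (Rel; REL; _Preserves_⟶_)
open import Relation.Binary.Definitions using (Decidable; DecidableEquality)
open import Relation.Binary.PropositionalEquality
  using (_≡_; _≢_; refl; sym; ≢-sym; trans; cong; cong₂; subst)
open import Relation.Nullary.Decidable
  using (Dec; yes; no; map′; decidable-stable; from-yes; _⊎-dec_; _→-dec_)
open import Relation.Nullary.Negation using (¬_; contradiction)
open import Relation.Unary using (Irrelevant)

private variable
  α β ρ ν ℓ ν′ ℓ′ : Level
  A B : Set α

-- Counting in duplicate-free lists.

lookup-injective : ∀ {xs : List A} → Unique xs → ∀ {i j} → lookup xs i ≡ lookup xs j → i ≡ j
lookup-injective (_ ∷ _) {zero} {zero} _ = refl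
lookup-injective (x∉ ∷ _) {zero} {suc j} eq = contradiction eq (All.lookup x∉ (∈-lookup j))
lookup-injective (x∉ ∷ _) {suc i} {zero} eq = contradiction (sym eq) (All.lookup x∉ (∈-lookup i))
lookup-injective (_ ∷ u) {suc i} {suc j} eq = cong suc (lookup-injective u eq)

unique-⊆⇒length-≤ : ∀ {xs ys : List A} → Unique xs → xs ⊆ ys → length xs ≤ length ys
unique-⊆⇒length-≤ {xs = xs} {ys} u sub = Fin.injective⇒≤ {f = f} inj
  where
  f : Fin (length xs) → Fin (length ys)
  f i = Any.index (sub (∈-lookup i))
  inj : ∀ {i j} → f i ≡ f j → i ≡ j
  inj {i} {j} eq = lookup-injective u
    (trans (lookup-index (sub (∈-lookup i)))
      (trans (cong (lookup ys) eq) (sym (lookup-index (sub (∈-lookup j))))))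

sum-map-const : ∀ {f : A → ℕ} {k} xs → (∀ {x} → x ∈ xs → f x ≡ k) → sum (map f xs) ≡ length xs * k
sum-map-const []       f≡k = refl
sum-map-const (x ∷ xs) f≡k = cong₂ _+_ (f≡k (here refl)) (sum-map-const xs λ x∈ → f≡k (there x∈))

length≤sum : ∀ {f : A → ℕ} xs → (∀ {x} → x ∈ xs → 1 ≤ f x) → length xs ≤ sum (map f xs)
length≤sum []       1≤f = z≤n
length≤sum (x ∷ xs) 1≤f = +-mono-≤ (1≤f (here refl)) (length≤sum xs λ x∈ → 1≤f (there x∈))

length<sum : ∀ {f : A → ℕ} {xs y} → (∀ {x} → x ∈ xs → 1 ≤ f x) → y ∈ xs → 2 ≤ f y →
             length xs < sum (map f xs)
length<sum {xs = x ∷ xs} 1≤f (here refl) 2≤f = +-mono-≤ 2≤f (length≤sum xs λ x∈ → 1≤f (there x∈))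
length<sum {xs = x ∷ xs} 1≤f (there y∈)  2≤f =
  +-mono-≤ (1≤f (here refl)) (length<sum (λ x∈ → 1≤f (there x∈)) y∈ 2≤f)

module DoubleCounting {A : Set α} {B : Set β} {R : REL A B ρ} (R? : Decidable R) where

  row : List B → A → ℕ
  row ys x = length (filter (R? x) ys)

  column : List A → B → ℕ
  column xs y = length (filter (λ x → R? x y) xs)

  column-∷ : ∀ x xs ys → sum (map (column (x ∷ xs)) ys) ≡ row ys x + sum (map (column xs) ys)
  column-∷ x xs [] = refl
  column-∷ x xs (y ∷ ys)
    with IH ← trans (cong (column xs y +_) (column-∷ x xs ys))
                    (x∙yz≈y∙xz (column xs y) (row ys x) (sum (map (column xs) ys)))
       | R? x y
  ... | yes _ = cong suc IH
  ... | no  _ = IH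

  column-[] : ∀ ys → sum (map (column []) ys) ≡ 0
  column-[] []       = refl
  column-[] (y ∷ ys) = column-[] ys

  sum-row≡sum-column : ∀ xs ys → sum (map (row ys) xs) ≡ sum (map (column xs) ys)
  sum-row≡sum-column []       ys = sym (column-[] ys)
  sum-row≡sum-column (x ∷ xs) ys =
    trans (cong (row ys x +_) (sum-row≡sum-column xs ys)) (sym (column-∷ x xs ys))

module Averaging {A : Set α} (_≟_ : DecidableEquality A) where
  open DecMembership _≟_ using (_∈?_)
  open DoubleCounting _∈?_

  -- Incidences of `T` with `U` number `length T * k = length U * w`, those with `X` number
  -- `length X * w`. Since `k * length X ≤ length U`, members of `T` meet `X` at most once on
  -- average; each meets it at least once, so none meets it twice.
  transversal-meets-once : ∀ {U X : List A} {T : List (List A)} {k w} →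
    Unique U → (∀ x → x ∈ U) → k * length X ≤ length U →
    (∀ {t} → t ∈ T → Unique t × length t ≡ k) →
    (∀ x → row T x ≡ w) →
    (∀ {t} → t ∈ T → Any (_∈ X) t) →
    ∀ {t} → t ∈ T → ∀ {p q} → p ∈ t → q ∈ t → p ∈ X → q ∈ X → p ≡ q
  transversal-meets-once {U} {X} {T} {k} {w} U! all kX≤U T! row≡w hit {t} t∈ {p} {q} p∈t q∈t p∈X q∈X
    with p ≟ q
  ... | yes p≡q = p≡q
  ... | no  p≢q = contradiction |T|k<|T|k (<-irrefl refl)
    where
    column-U : ∀ {s} → s ∈ T → column U s ≡ k
    column-U {s} s∈ = trans
      (≤-antisym
        (unique-⊆⇒length-≤ (filter⁺ (_∈? s) U!) λ x∈ → proj₂ (∈-filter⁻ (_∈? s) {xs = U} x∈))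
        (unique-⊆⇒length-≤ (proj₁ (T! s∈)) λ {x} x∈ → ∈-filter⁺ (_∈? s) (all x) x∈))
      (proj₂ (T! s∈))

    column-X : ∀ {s} → s ∈ T → 1 ≤ column X s
    column-X {s} s∈ = let y , y∈s , y∈X = find (hit s∈) in ∈-length (∈-filter⁺ (_∈? s) y∈X y∈s)

    [p,q]⊆ : (p ∷ q ∷ []) ⊆ filter (_∈? t) X
    [p,q]⊆ (here refl)         = ∈-filter⁺ (_∈? t) p∈X p∈t
    [p,q]⊆ (there (here refl)) = ∈-filter⁺ (_∈? t) q∈X q∈t

    |T|<sum : length T < sum (map (column X) T)
    |T|<sum = length<sum column-X t∈ (unique-⊆⇒length-≤ ((p≢q ∷ []) ∷ [] ∷ []) [p,q]⊆)

    instance k≢0 : NonZero k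
    k≢0 = >-nonZero (subst (0 <_) (proj₂ (T! t∈)) (∈-length p∈t))

    |T|k<|T|k : length T * k < length T * k
    |T|k<|T|k = begin-strict
      length T * k                 <⟨ *-monoˡ-< k |T|<sum ⟩
      sum (map (column X) T) * k   ≡⟨ cong (_* k) (sum-row≡sum-column X T) ⟨
      sum (map (row T) X) * k      ≡⟨ cong (_* k) (sum-map-const X λ {x} _ → row≡w x) ⟩
      length X * w * k             ≡⟨ *-comm (length X * w) k ⟩
      k * (length X * w)           ≡⟨ *-assoc k (length X) w ⟨
      k * length X * w             ≤⟨ *-monoˡ-≤ w kX≤U ⟩
      length U * w                 ≡⟨ sum-map-const U (λ {x} _ → row≡w x) ⟨
      sum (map (row T) U)          ≡⟨ sum-row≡sum-column U T ⟩
      sum (map (column U) T)       ≡⟨ sum-map-const T column-U ⟩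
      length T * k                 ∎
      where open ≤-Reasoning

-- Homogeneous graphs: forks, degrees and diamonds.

pattern 1st = here refl
pattern 2nd = there 1st
pattern 3rd = there 2nd
pattern 4th = there 3rd

lower-em : ∀ a b → ExcludedMiddle (a ⊔ b) → ExcludedMiddle a
lower-em a b em = map′ lower lift (em {P = Lift b _})

-- The trace of vertex-transitivity on a bare relation: such maps carry forks, neighbours and
-- diamonds from any vertex to any other.
Homogeneous : {V : Set ν} → Rel V ℓ → Set (ν ⊔ ℓ)
Homogeneous {V = V} _~_ = (x y : V) →
  Σ[ φ ∈ (V → V) ] Injective _≡_ _≡_ φ × φ Preserves _~_ ⟶ _~_ × φ x ≡ y

module HomogeneousGraph {ν ℓ} {V : Set ν} (_~_ : Rel V ℓ)
  (~-sym : ∀ {x y} → x ~ y → y ~ x) (~-irrefl : ∀ {x} → ¬ x ~ x)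
  (em : ExcludedMiddle (ν ⊔ ℓ)) (homogeneous : Homogeneous _~_)
  where

  _≟_ : DecidableEquality V
  _ ≟ _ = lower-em ν ℓ em

  _~?_ : Decidable _~_
  _ ~? _ = lower-em ℓ ν em

  open DecMembership _≟_ using (_∈?_)

  private variable
    u u′ v a b c d x y p q : V
    L : List V

  ~⇒≢ : x ~ y → x ≢ y
  ~⇒≢ x~y refl = ~-irrefl x~y

  -- Copies of `D₅` as labelled lists. Interchanging `a` and `b` gives a second list for the same
  -- copy, which does no harm to the incidence count.
  data Fork : List V → Set (ν ⊔ ℓ) where
    fork : Unique (v ∷ a ∷ b ∷ c ∷ d ∷ []) → v ~ a → v ~ b → v ~ c → c ~ d → Fork (v ∷ a ∷ b ∷ c ∷ d ∷ [])

  mkFork : v ~ a → v ~ b → v ~ c → c ~ d → a ≢ b → a ≢ c → b ≢ c → v ≢ d → a ≢ d → b ≢ d →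
           Fork (v ∷ a ∷ b ∷ c ∷ d ∷ [])
  mkFork v~a v~b v~c c~d a≢b a≢c b≢c v≢d a≢d b≢d = fork
    ((~⇒≢ v~a ∷ ~⇒≢ v~b ∷ ~⇒≢ v~c ∷ v≢d ∷ []) ∷ (a≢b ∷ a≢c ∷ a≢d ∷ []) ∷ (b≢c ∷ b≢d ∷ []) ∷
     (~⇒≢ c~d ∷ []) ∷ [] ∷ [])
    v~a v~b v~c c~d

  N_⊆_ : V → List V → Set (ν ⊔ ℓ)
  N u ⊆ L = ∀ {y} → u ~ y → y ∈ L

  N⊆-by-contradiction : (∀ {y} → u ~ y → All (y ≢_) L → ⊥) → N u ⊆ L
  N⊆-by-contradiction {L = L} absurd {y} u~y with y ∈? L
  ... | yes y∈L = y∈L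
  ... | no  y∉L = ⊥-elim (absurd u~y (¬Any⇒All¬ L y∉L))

  -- The map taking `u` to `u′` sends `ps` injectively into `L`. A lower bound on the degree at one
  -- vertex can thus contradict an upper bound at another.
  degree-≤ : ∀ {ps} → Unique ps → (∀ {p} → p ∈ ps → u ~ p) → N u′ ⊆ L → length ps ≤ length L
  degree-≤ {u} {u′} {L} {ps} ps! u~ps Nu′⊆L
    with φ , φ-inj , φ-~ , refl ← homogeneous u u′ =
    subst (_≤ length L) (length-map φ ps) (unique-⊆⇒length-≤ (map⁺ φ-inj ps!) map⊆L)
    where
    map⊆L : map φ ps ⊆ L
    map⊆L q∈ with p , p∈ , refl ← ∈-map⁻ φ q∈ = Nu′⊆L (φ-~ (u~ps p∈))

  -- `u` is a middle vertex of a diamond: the triangles `u p q` and `u q r` share the edge `u q`.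
  -- The vertices `p` and `r` may be adjacent too.
  Diamond : V → Set (ν ⊔ ℓ)
  Diamond u = ∃[ p ] ∃[ q ] ∃[ r ]
    Unique (p ∷ q ∷ r ∷ []) × (∀ {y} → y ∈ p ∷ q ∷ r ∷ [] → u ~ y) × p ~ q × q ~ r

  Diamond-homogeneous : Diamond u → ∀ u′ → Diamond u′
  Diamond-homogeneous {u} (p , q , r , pqr! , u~ , p~q , q~r) u′
    with φ , φ-inj , φ-~ , refl ← homogeneous u u′ =
    φ p , φ q , φ r , map⁺ φ-inj pqr! , φu~ , φ-~ p~q , φ-~ q~r
    where
    φu~ : ∀ {y} → y ∈ map φ (p ∷ q ∷ r ∷ []) → φ u ~ y
    φu~ y∈ with z , z∈ , refl ← ∈-map⁻ φ y∈ = φ-~ (u~ z∈)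

  -- Each of the three outer vertices of a diamond at u has a neighbour among
  -- the other two, so none of them is the isolated one.
  isolated⇒¬Diamond : N u ⊆ (a ∷ b ∷ c ∷ []) → ¬ c ~ a → ¬ c ~ b → ¬ Diamond u
  isolated⇒¬Diamond {u} {a} {b} {c} Nu c≁a c≁b (p , q , r , pqr! , u~ , p~q , q~r) =
    contradiction (unique-⊆⇒length-≤ pqr! pqr⊆ab) λ { (s≤s (s≤s ())) }
    where
    ~⇒∈ab : u ~ x → u ~ y → x ~ y → x ∈ a ∷ b ∷ []
    ~⇒∈ab u~x u~y x~y with Nu u~x
    ... | 1st = 1st
    ... | 2nd = 2nd
    ... | 3rd with Nu u~y
    ...   | 1st = contradiction x~y c≁a
    ...   | 2nd = contradiction x~y c≁b
    ...   | 3rd = contradiction x~y ~-irrefl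
    pqr⊆ab : (p ∷ q ∷ r ∷ []) ⊆ (a ∷ b ∷ [])
    pqr⊆ab 1st = ~⇒∈ab (u~ 1st) (u~ 2nd) p~q
    pqr⊆ab 2nd = ~⇒∈ab (u~ 2nd) (u~ 3rd) q~r
    pqr⊆ab 3rd = ~⇒∈ab (u~ 3rd) (u~ 2nd) (~-sym q~r)

  -- Neighbourhoods around a fork whose tip lies in an exact transversal.

  module ExactTransversal (X : List V)
    (hit : ∀ {t} → Fork t → Any (_∈ X) t)
    (once : ∀ {t} → Fork t → ∀ {p q} → p ∈ t → q ∈ t → p ∈ X → q ∈ X → p ≡ q)
    where

    exit : All (_∉ X) (v ∷ a ∷ b ∷ c ∷ []) → Fork (v ∷ a ∷ b ∷ c ∷ d ∷ []) → d ∈ X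
    exit (v∉ ∷ a∉ ∷ b∉ ∷ c∉ ∷ []) F with hit F
    ... | here v∈ = contradiction v∈ v∉
    ... | there (here a∈) = contradiction a∈ a∉
    ... | there (there (here b∈)) = contradiction b∈ b∉
    ... | there (there (there (here c∈))) = contradiction c∈ c∉
    ... | there (there (there (there (here d∈)))) = d∈

    ¬[a,b∈X] : Fork (v ∷ a ∷ b ∷ c ∷ d ∷ []) → a ∈ X → b ∈ X → ⊥
    ¬[a,b∈X] F@(fork (_ ∷ (a≢b ∷ _) ∷ _) _ _ _ _) a∈ b∈ = a≢b (once F 2nd 3rd a∈ b∈)

    ¬[a,d∈X] : Fork (v ∷ a ∷ b ∷ c ∷ d ∷ []) → a ∈ X → d ∈ X → ⊥
    ¬[a,d∈X] F@(fork (_ ∷ (_ ∷ _ ∷ a≢d ∷ _) ∷ _) _ _ _ _) a∈ d∈ = a≢d (once F 2nd (there 4th) a∈ d∈)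

    -- A fork whose only vertex in `X` is its end `x`. The inequalities stored are those that do not
    -- follow from adjacency.
    record Tip (v a b c x : V) : Set (ν ⊔ ℓ) where
      field
        v~a : v ~ a
        v~b : v ~ b
        v~c : v ~ c
        c~x : c ~ x
        a≢b : a ≢ b
        a≢c : a ≢ c
        b≢c : b ≢ c
        v≢x : v ≢ x
        a≢x : a ≢ x
        b≢x : b ≢ x
        x∈X : x ∈ X

      tip-fork : Fork (v ∷ a ∷ b ∷ c ∷ x ∷ [])
      tip-fork = mkFork v~a v~b v~c c~x a≢b a≢c b≢c v≢x a≢x b≢x

      v∉X : v ∉ X
      v∉X v∈ = v≢x (once tip-fork 1st (there 4th) v∈ x∈X)
      a∉X : a ∉ X
      a∉X a∈ = a≢x (once tip-fork 2nd (there 4th) a∈ x∈X)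
      b∉X : b ∉ X
      b∉X b∈ = b≢x (once tip-fork 3rd (there 4th) b∈ x∈X)
      c∉X : c ∉ X
      c∉X c∈ = ~⇒≢ c~x (once tip-fork 4th (there 4th) c∈ x∈X)

    swap-ab : Tip v a b c x → Tip v b a c x
    swap-ab T = record
      { v~a = v~b ; v~b = v~a ; v~c = v~c ; c~x = c~x ; a≢b = ≢-sym a≢b ; a≢c = b≢c ; b≢c = a≢c
      ; v≢x = v≢x ; a≢x = b≢x ; b≢x = a≢x ; x∈X = x∈X }
      where open Tip T

    replace-a : Tip v a b c x → v ~ d → d ≢ b → d ≢ c → d ≢ x → Tip v d b c x
    replace-a T v~d d≢b d≢c d≢x = record
      { v~a = v~d ; v~b = v~b ; v~c = v~c ; c~x = c~x ; a≢b = d≢b ; a≢c = d≢c ; b≢c = b≢c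
      ; v≢x = v≢x ; a≢x = d≢x ; b≢x = b≢x ; x∈X = x∈X }
      where open Tip T

    -- For a further neighbour `y` of `c`, exchanging the tip for `y` gives a fork whose other
    -- vertices avoid `X`, so `y ∈ X`. The fork centred at `c` with leaves `x`, `y` and branch `v`,
    -- `a` then meets `X` twice.
    N-c : Tip v a b c x → N c ⊆ (v ∷ a ∷ b ∷ x ∷ [])
    N-c T = N⊆-by-contradiction λ { c~y (y≢v ∷ y≢a ∷ y≢b ∷ y≢x ∷ []) →
      ¬[a,b∈X]
        (mkFork c~x c~y (~-sym v~c) v~a (≢-sym y≢x) (≢-sym v≢x) y≢v (≢-sym a≢c) (≢-sym a≢x) y≢a)
        x∈X
        (exit (v∉X ∷ a∉X ∷ b∉X ∷ c∉X ∷ [])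
          (mkFork v~a v~b v~c c~y a≢b a≢c b≢c (≢-sym y≢v) (≢-sym y≢a) (≢-sym y≢b))) }
      where open Tip T

    abc! : Tip v a b c x → Unique (a ∷ b ∷ c ∷ [])
    abc! T = (a≢b ∷ a≢c ∷ []) ∷ (b≢c ∷ []) ∷ [] ∷ []
      where open Tip T

    v~abc : Tip v a b c x → y ∈ a ∷ b ∷ c ∷ [] → v ~ y
    v~abc T = λ { 1st → v~a ; 2nd → v~b ; 3rd → v~c }
      where open Tip T

    degree≥3 : Tip v a b c x → N u ⊆ L → 3 ≤ length L
    degree≥3 T = degree-≤ (abc! T) (v~abc T)

    -- A further neighbour `f` of `v` can stand in for `a` or for `b`. Applied to both variants,
    -- `N-c` excludes `a` and `b` from the neighbours of `c`, which leaves `c` with degree at most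
    -- two.
    N-v : Tip v a b c x → N v ⊆ (a ∷ b ∷ c ∷ x ∷ [])
    N-v {v} {a} {b} {c} {x} T = N⊆-by-contradiction absurd
      where
      open Tip T
      absurd : ∀ {f} → v ~ f → All (f ≢_) (a ∷ b ∷ c ∷ x ∷ []) → ⊥
      absurd {f} v~f (f≢a ∷ f≢b ∷ f≢c ∷ f≢x ∷ []) =
        contradiction (degree≥3 T Nc⊆) λ { (s≤s (s≤s ())) }
        where
        Nc⊆ : N c ⊆ (v ∷ x ∷ [])
        Nc⊆ c~y with N-c T c~y
        ... | 1st = 1st
        ... | 4th = 2nd
        Nc⊆ c~y | 2nd with N-c (replace-a T v~f f≢b f≢c f≢x) c~y
        ... | 1st = 1st
        ... | 2nd = contradiction refl f≢a
        ... | 3rd = contradiction refl a≢b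
        ... | 4th = 2nd
        Nc⊆ c~y | 3rd with N-c (replace-a (swap-ab T) v~f f≢a f≢c f≢x) c~y
        ... | 1st = 1st
        ... | 2nd = contradiction refl f≢b
        ... | 3rd = contradiction refl a≢b
        ... | 4th = 2nd

    -- For a further neighbour `y` of `a`, the fork centred at `v` with leaves `b`, `c` and branch
    -- `a`, `y` forces `y ∈ X`. The fork centred at `c` with leaves `x`, `v` and branch `a`, `y`
    -- then contains both `x` and `y`.
    N-a : Tip v a b c x → c ~ a → N a ⊆ (v ∷ b ∷ c ∷ x ∷ [])
    N-a T c~a = N⊆-by-contradiction λ { a~y (y≢v ∷ y≢b ∷ y≢c ∷ y≢x ∷ []) →
      ¬[a,d∈X]
        (mkFork c~x (~-sym v~c) c~a a~y (≢-sym v≢x) (≢-sym a≢x) (~⇒≢ v~a) (≢-sym y≢c) (≢-sym y≢x) (≢-sym y≢v))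
        x∈X
        (exit (v∉X ∷ b∉X ∷ c∉X ∷ a∉X ∷ [])
          (mkFork v~b v~c v~a a~y b≢c (≢-sym a≢b) (≢-sym a≢c) (≢-sym y≢v) (≢-sym y≢b) (≢-sym y≢c))) }
      where open Tip T

    -- Here `c` has at most three neighbours, so all degrees are three. Hence `v` is not adjacent to
    -- `x`, and `a` is adjacent to exactly one of `b` and `x`. If to `b`, there is a diamond at `v`,
    -- but `x` is isolated among the neighbours of `c`. If to `x`, there is a diamond at `c`, but
    -- `b` is isolated among the neighbours of `v`.
    c≁b⇒⊥ : Tip v a b c x → c ~ a → ¬ c ~ b → ⊥
    c≁b⇒⊥ {v} {a} {b} {c} {x} T c~a c≁b = case
      where
      open Tip T
      Nc⊆ : N c ⊆ (v ∷ a ∷ x ∷ [])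
      Nc⊆ c~y with N-c T c~y
      ... | 1st = 1st
      ... | 2nd = 2nd
      ... | 3rd = contradiction c~y c≁b
      ... | 4th = 3rd

      v≁x : ¬ v ~ x
      v≁x v~x = contradiction
        (degree-≤ {ps = a ∷ b ∷ c ∷ x ∷ []}
          ((a≢b ∷ a≢c ∷ a≢x ∷ []) ∷ (b≢c ∷ b≢x ∷ []) ∷ (~⇒≢ c~x ∷ []) ∷ [] ∷ [])
          (λ { 1st → v~a ; 2nd → v~b ; 3rd → v~c ; 4th → v~x }) Nc⊆)
        λ { (s≤s (s≤s (s≤s ()))) }

      -- `b` comes last, where `isolated⇒¬Diamond` expects the isolated neighbour.
      Nv⊆ : N v ⊆ (a ∷ c ∷ b ∷ [])
      Nv⊆ v~y with N-v T v~y
      ... | 1st = 1st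
      ... | 2nd = 3rd
      ... | 3rd = 2nd
      ... | 4th = contradiction v~y v≁x

      ¬[a~b,a~x] : a ~ b → a ~ x → ⊥
      ¬[a~b,a~x] a~b a~x = contradiction
        (degree-≤ {ps = v ∷ b ∷ c ∷ x ∷ []}
          ((~⇒≢ v~b ∷ ~⇒≢ v~c ∷ v≢x ∷ []) ∷ (b≢c ∷ b≢x ∷ []) ∷ (~⇒≢ c~x ∷ []) ∷ [] ∷ [])
          (λ { 1st → ~-sym v~a ; 2nd → a~b ; 3rd → ~-sym c~a ; 4th → a~x }) Nc⊆)
        λ { (s≤s (s≤s (s≤s ()))) }

      Na⊆ : ¬ a ~ b → ¬ a ~ x → N a ⊆ (v ∷ c ∷ [])
      Na⊆ a≁b a≁x a~y with N-a T c~a a~y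
      ... | 1st = 1st
      ... | 2nd = contradiction a~y a≁b
      ... | 3rd = 2nd
      ... | 4th = contradiction a~y a≁x

      case : ⊥
      case with a ~? b | a ~? x
      ... | yes a~b | yes a~x = ¬[a~b,a~x] a~b a~x
      ... | yes a~b | no  a≁x = isolated⇒¬Diamond Nc⊆ (v≁x ∘ ~-sym) (a≁x ∘ ~-sym)
        (Diamond-homogeneous
          (c , a , b , ((≢-sym a≢c ∷ ≢-sym b≢c ∷ []) ∷ (a≢b ∷ []) ∷ [] ∷ [])
             , (λ { 1st → v~c ; 2nd → v~a ; 3rd → v~b }) , c~a , a~b) c)
      ... | no  a≁b | yes a~x = isolated⇒¬Diamond Nv⊆ (a≁b ∘ ~-sym) (c≁b ∘ ~-sym)
        (Diamond-homogeneous
          (v , a , x , ((~⇒≢ v~a ∷ v≢x ∷ []) ∷ (a≢x ∷ []) ∷ [] ∷ [])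
             , (λ { 1st → ~-sym v~c ; 2nd → c~a ; 3rd → c~x }) , v~a , a~x) v)
      ... | no  a≁b | no  a≁x =
        contradiction (degree≥3 T (Na⊆ a≁b a≁x)) λ { (s≤s (s≤s ())) }

    NeighbourClosed : List V → Set (ν ⊔ ℓ)
    NeighbourClosed S = ∀ {y} → y ∈ S → N y ⊆ S

    -- Now `c` has four neighbours, so all degrees are four. Each of `v`, `a`, `b` has only four
    -- candidate neighbours, `x` among them, so all three are adjacent to `x`; together with `c`
    -- they exhaust the neighbours of `x`.
    c~a,b⇒closed : Tip v a b c x → c ~ a → c ~ b → NeighbourClosed (v ∷ a ∷ b ∷ c ∷ x ∷ [])
    c~a,b⇒closed {v} {a} {b} {c} {x} T c~a c~b = span-closed
      where
      open Tip T
      degree≥4 : N u ⊆ L → 4 ≤ length L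
      degree≥4 = degree-≤ {ps = v ∷ a ∷ b ∷ x ∷ []}
        ((~⇒≢ v~a ∷ ~⇒≢ v~b ∷ v≢x ∷ []) ∷ (a≢b ∷ a≢x ∷ []) ∷ (b≢x ∷ []) ∷ [] ∷ [])
        (λ { 1st → ~-sym v~c ; 2nd → c~a ; 3rd → c~b ; 4th → c~x })

      adjacent-to-x : N u ⊆ (p ∷ q ∷ y ∷ x ∷ []) → u ~ x
      adjacent-to-x {u} {p} {q} {y} Nu with u ~? x
      ... | yes u~x = u~x
      ... | no  u≁x = contradiction (degree≥4 Nu⊆) λ { (s≤s (s≤s (s≤s ()))) }
        where
        Nu⊆ : N u ⊆ (p ∷ q ∷ y ∷ [])
        Nu⊆ u~z with Nu u~z
        ... | 1st = 1st
        ... | 2nd = 2nd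
        ... | 3rd = 3rd
        ... | 4th = contradiction u~z u≁x

      Na = N-a T c~a
      Nb = N-a (swap-ab T) c~b

      x~v : x ~ v
      x~v = ~-sym (adjacent-to-x (N-v T))
      x~a : x ~ a
      x~a = ~-sym (adjacent-to-x Na)
      x~b : x ~ b
      x~b = ~-sym (adjacent-to-x Nb)

      Nx : N x ⊆ (v ∷ a ∷ b ∷ c ∷ [])
      Nx = N⊆-by-contradiction λ { {y} x~y y∉@(_ ∷ _ ∷ _ ∷ _ ∷ []) → contradiction
        (degree-≤ {ps = y ∷ v ∷ a ∷ b ∷ c ∷ []}
          (y∉ ∷ (~⇒≢ v~a ∷ ~⇒≢ v~b ∷ ~⇒≢ v~c ∷ []) ∷ abc! T)
          (λ { 1st → x~y ; 2nd → x~v ; 3rd → x~a ; 4th → x~b ; (there 4th) → ~-sym c~x }) (N-c T))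
        λ { (s≤s (s≤s (s≤s (s≤s ())))) } }

      span-closed : NeighbourClosed (v ∷ a ∷ b ∷ c ∷ x ∷ [])
      span-closed 1st         = there ∘ N-v T
      span-closed 2nd a~y with Na a~y
      ... | 1st = 1st
      ... | 2nd = 3rd
      ... | 3rd = 4th
      ... | 4th = there 4th
      span-closed 3rd b~y with Nb b~y
      ... | 1st = 1st
      ... | 2nd = 2nd
      ... | 3rd = 4th
      ... | 4th = there 4th
      span-closed 4th c~y with N-c T c~y
      ... | 1st = 1st
      ... | 2nd = 2nd
      ... | 3rd = 3rd
      ... | 4th = there 4th
      span-closed (there 4th) x~y with Nx x~y
      ... | 1st = 1st
      ... | 2nd = 2nd
      ... | 3rd = 3rd
      ... | 4th = 4th

    tip⇒closed : Tip v a b c x → Σ[ S ∈ List V ] v ∈ S × length S ≡ 5 × NeighbourClosed S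
    tip⇒closed {v} {a} {b} {c} {x} T with c ~? a | c ~? b
    ... | yes c~a | yes c~b = _ , 1st , refl , c~a,b⇒closed T c~a c~b
    ... | yes c~a | no  c≁b = ⊥-elim (c≁b⇒⊥ T c~a c≁b)
    ... | no  c≁a | yes c~b = ⊥-elim (c≁b⇒⊥ (swap-ab T) c~b c≁a)
    ... | no  c≁a | no  c≁b = contradiction (degree≥3 T Nc⊆) λ { (s≤s (s≤s ())) }
      where
      Nc⊆ : N c ⊆ (v ∷ x ∷ [])
      Nc⊆ c~y with N-c T c~y
      ... | 1st = 1st
      ... | 2nd = contradiction c~y c≁a
      ... | 3rd = contradiction c~y c≁b
      ... | 4th = 2nd

  -- Finiteness of the vertex set.

  map-fork : ∀ {φ : V → V} {t} → Injective _≡_ _≡_ φ → φ Preserves _~_ ⟶ _~_ → Fork t → Fork (map φ t)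
  map-fork inj pres (fork t! v~a v~b v~c c~d) =
    fork (map⁺ inj t!) (pres v~a) (pres v~b) (pres v~c) (pres c~d)

  module Transversal {X : List V} (hit : ∀ {t} → Fork t → Any (_∈ X) t) {t₀ : List V} (fork₀ : Fork t₀) where

    ¬avoids : Fork (v ∷ a ∷ b ∷ c ∷ d ∷ []) → ¬ All (_∉ X) (v ∷ a ∷ b ∷ c ∷ d ∷ [])
    ¬avoids F avoid = All¬⇒¬Any avoid (hit F)

    module _ (outside : (L : List V) → ∃[ x ] x ∉ L) where

      -- One infinite degree makes all degrees infinite, so a fork can be built greedily outside
      -- `X`.
      infinite-degree⇒⊥ : (∀ L → ¬ N u ⊆ L) → ⊥
      infinite-degree⇒⊥ {u} Nu⊈ =
        -- Each choice avoids `X` and those earlier vertices from which adjacency does not already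
        -- separate the new one.
        let c , c∉ = outside X
            v , c~v , v∉ = another c X
            d , c~d , d∉ = another c (v ∷ X)
            a , v~a , a∉ = another v (c ∷ d ∷ X)
            b , v~b , b∉ = another v (a ∷ c ∷ d ∷ X)
        in ¬avoids
             (mkFork v~a v~b (~-sym c~v) c~d (≢-sym (b∉ ∘ here)) (a∉ ∘ here) (b∉ ∘ there ∘ here)
               (≢-sym (d∉ ∘ here)) (a∉ ∘ there ∘ here) (b∉ ∘ there ∘ there ∘ here))
             (v∉ ∷ a∉ ∘ there ∘ there ∷ b∉ ∘ there ∘ there ∘ there ∷ c∉ ∷ d∉ ∘ there ∷ [])
        where
        outside-N : (∀ L → ¬ N u′ ⊆ L) → ∀ L → ∃[ y ] u′ ~ y × y ∉ L
        outside-N Nu′⊈ L = decidable-stable em λ none →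
          Nu′⊈ L (N⊆-by-contradiction λ u′~y y∉ → none (_ , u′~y , All¬⇒¬Any y∉))

        neighbours : ∀ n → ∃[ ps ] Unique ps × (∀ {p} → p ∈ ps → u ~ p) × length ps ≡ n
        neighbours zero = [] , [] , (λ ()) , refl
        neighbours (suc n) with ps , ps! , u~ps , refl ← neighbours n =
          let y , u~y , y∉ = outside-N Nu⊈ ps in
          y ∷ ps , ¬Any⇒All¬ ps y∉ ∷ ps! , (λ { 1st → u~y ; (there p∈) → u~ps p∈ }) , refl

        another : ∀ w L → ∃[ y ] w ~ y × y ∉ L
        another w = outside-N λ L Nw⊆L →
          let ps , ps! , u~ps , |ps| = neighbours (suc (length L)) in
          <-irrefl refl (subst (_≤ length L) |ps| (degree-≤ ps! u~ps Nw⊆L))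

      -- A fork lies within distance two of its centre `v`. Two rounds of `ball` around `X` still
      -- give a finite list, so `v` can be moved outside it, and the moved fork misses `X`.
      locally-finite⇒⊥ : (∀ u → ∃[ L ] N u ⊆ L) → ⊥
      locally-finite⇒⊥ N-list = far fork₀
        where
        ball : List V → List V
        ball L = L ++ concatMap (proj₁ ∘ N-list) L

        ⊆ball : L ⊆ ball L
        ⊆ball = ∈-++⁺ˡ

        N-ball : x ∈ L → y ~ x → y ∈ ball L
        N-ball {x} {L} x∈ y~x =
          ∈-++⁺ʳ L (∈-concatMap⁺ (proj₁ ∘ N-list) (lose x∈ (proj₂ (N-list x) (~-sym y~x))))

        far : Fork L → ⊥
        far F@(fork {v} {a} {b} {c} {d} _ v~a v~b v~c c~d)
          with u , u∉ ← outside (ball (ball X))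
          with φ , φ-inj , φ-~ , refl ← homogeneous v u =
          ¬avoids (map-fork φ-inj φ-~ F)
            ( u∉ ∘ ⊆ball ∘ ⊆ball
            ∷ u∉N ∘ φ-~v v~a
            ∷ u∉N ∘ φ-~v v~b
            ∷ u∉N ∘ φ-~v v~c
            ∷ (λ φd∈ → u∉ (N-ball (N-ball φd∈ (φ-~ c~d)) (φ-~ v~c)))
            ∷ [])
          where
          φ-~v : v ~ x → φ x ∈ X → φ v ∈ ball X
          φ-~v v~x φx∈ = N-ball φx∈ (φ-~ v~x)
          u∉N : φ v ∉ ball X
          u∉N = u∉ ∘ ⊆ball

    finite : ∃[ U ] Unique U × (∀ x → x ∈ U)
    finite = decidable-stable (lower-em ν ℓ em) λ infinite →
      -- An exhaustive list could be freed of repetitions, so if finiteness fails, every list omits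
      -- a vertex.
      let outside = λ L → decidable-stable (lower-em ν ℓ em) λ none → infinite
            ( deduplicate _≟_ L , deduplicate-! _≟_ L
            , λ x → ∈-deduplicate⁺ _≟_ (decidable-stable (x ∈? L) λ x∉ → none (x , x∉)))
      in locally-finite⇒⊥ outside λ u → decidable-stable em λ Nu⊈ →
           infinite-degree⇒⊥ outside λ L Nu⊆L → Nu⊈ (L , λ {_} → Nu⊆L)

    -- Incidence count in the finite graph.

    module _ (connected : ∀ x y → Star _~_ x y) {Y : List V} (Y! : Unique Y) (5<|Y| : 5 < length Y)
      {U : List V} (U! : Unique U) (∈U : ∀ x → x ∈ U) where

      words : ℕ → List (List V)
      words zero    = [] ∷ []
      words (suc n) = cartesianProductWith _∷_ U (words n)

      words! : ∀ n → Unique (words n)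
      words! zero    = [] ∷ []
      words! (suc n) = cartesianProductWith⁺ _∷_ ∷-injective U! (words! n)

      ∈-words : ∀ t → t ∈ words (length t)
      ∈-words []      = here refl
      ∈-words (x ∷ t) = ∈-cartesianProductWith⁺ _∷_ (∈U x) (∈-words t)

      Fork? : ∀ t → Dec (Fork t)
      Fork? t = em

      forks : List (List V)
      forks = filter Fork? (words 5)

      fork⇒∈forks : ∀ {t} → Fork t → t ∈ forks
      fork⇒∈forks F@(fork _ _ _ _ _) = ∈-filter⁺ Fork? (∈-words _) F

      ∈forks⇒fork : ∀ {t} → t ∈ forks → Fork t
      ∈forks⇒fork t∈ = proj₂ (∈-filter⁻ Fork? {xs = words 5} t∈)

      open DoubleCounting _∈?_ using (row)

      -- The map taking `x` to `y` sends distinct forks through `x` to distinct forks through `y`.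
      -- Used in both directions, this makes the number of forks through a vertex constant.
      row-≤ : ∀ x y → row forks x ≤ row forks y
      row-≤ x y with φ , φ-inj , φ-~ , refl ← homogeneous x y =
        subst (_≤ row forks (φ x)) (length-map (map φ) through-x)
          (unique-⊆⇒length-≤ (map⁺ (map-injective φ-inj) (filter⁺ (x ∈?_) (filter⁺ Fork? (words! 5)))) sub)
        where
        through-x = filter (x ∈?_) forks
        sub : map (map φ) through-x ⊆ filter (φ x ∈?_) forks
        sub t∈ with s , s∈ , refl ← ∈-map⁻ (map φ) t∈ =
          let s∈forks , x∈s = ∈-filter⁻ (x ∈?_) {xs = forks} s∈ in
          ∈-filter⁺ (φ x ∈?_) (fork⇒∈forks (map-fork φ-inj φ-~ (∈forks⇒fork s∈forks))) (∈-map⁺ φ x∈s)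

      fork-vertices : ∀ {t} → Fork t → Unique t × length t ≡ 5
      fork-vertices (fork t! _ _ _ _) = t! , refl

      module _ (5X≤U : 5 * length X ≤ length U) where

        once : ∀ {t} → Fork t → ∀ {p q} → p ∈ t → q ∈ t → p ∈ X → q ∈ X → p ≡ q
        once F@(fork {v} _ _ _ _ _) = transversal-meets-once U! ∈U 5X≤U
          (λ t∈ → fork-vertices (∈forks⇒fork t∈)) (λ x → ≤-antisym (row-≤ x v) (row-≤ v x))
          (λ t∈ → hit (∈forks⇒fork t∈)) (fork⇒∈forks F)
          where open Averaging _≟_

        open ExactTransversal X hit once

        reach : ∀ {S} → NeighbourClosed S → Star _~_ x y → x ∈ S → y ∈ S
        reach closed ε            x∈S = x∈S
        reach closed (x~z ◅ rest) x∈S = reach closed rest (closed x∈S x~z)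

        move-tip : Fork L → ∃[ v ] ∃[ a ] ∃[ b ] ∃[ c ] ∃[ x ] Tip v a b c x
        move-tip F@(fork {d = d} ((_ ∷ _ ∷ _ ∷ v≢d ∷ []) ∷ (a≢b ∷ a≢c ∷ a≢d ∷ []) ∷ (b≢c ∷ b≢d ∷ []) ∷ _)
                         v~a v~b v~c c~d)
          with x , _ , x∈X ← find (hit F)
          with φ , φ-inj , φ-~ , refl ← homogeneous d x = _ , _ , _ , _ , _ , record
            { v~a = φ-~ v~a ; v~b = φ-~ v~b ; v~c = φ-~ v~c ; c~x = φ-~ c~d
            ; a≢b = a≢b ∘ φ-inj ; a≢c = a≢c ∘ φ-inj ; b≢c = b≢c ∘ φ-inj
            ; v≢x = v≢d ∘ φ-inj ; a≢x = a≢d ∘ φ-inj ; b≢x = b≢d ∘ φ-inj ; x∈X = x∈X }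

        -- By connectedness the closed list of five vertices exhausts the graph, against
        -- `5 < length Y`.
        dense⇒⊥ : ⊥
        dense⇒⊥ =
          let _ , _ , _ , _ , _ , T = move-tip fork₀
              S , v∈S , |S|≡5 , closed = tip⇒closed T
          in <⇒≱ 5<|Y| (subst (length Y ≤_) |S|≡5
               (unique-⊆⇒length-≤ Y! λ {y} _ → reach closed (connected _ y) v∈S))

      length-U< : length U < 5 * length X
      length-U< = ≰⇒> dense⇒⊥

-- Embeddings and copies of a graph in `Γ`.

≈ₑ-sym : {p q : A × A} → p ≈ₑ q → q ≈ₑ p
≈ₑ-sym (inj₁ eq) = inj₁ (sym eq)
≈ₑ-sym (inj₂ eq) = inj₂ (sym (cong swap eq))

≈ₑ-trans : {p q r : A × A} → p ≈ₑ q → q ≈ₑ r → p ≈ₑ r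
≈ₑ-trans (inj₁ refl) q≈r         = q≈r
≈ₑ-trans (inj₂ refl) (inj₁ refl) = inj₂ refl
≈ₑ-trans (inj₂ refl) (inj₂ refl) = inj₁ refl

≈ₑ-map : (g : A → B) {p q : A × A} → p ≈ₑ q → map× g g p ≈ₑ map× g g q
≈ₑ-map g (inj₁ refl) = inj₁ refl
≈ₑ-map g (inj₂ refl) = inj₂ refl

-- Absence of parallel edges, which makes the edge map of an embedding injective once its vertex map
-- is.
Simple : Graph ν ℓ → Set (ν ⊔ ℓ)
Simple K = ∀ i j → ends K i ≈ₑ ends K j → i ≡ j

D₅-simple : Simple D₅
D₅-simple = from-yes (Fin.all? λ i → Fin.all? λ j → (ends D₅ i ≈? ends D₅ j) →-dec (i Fin.≟ j))
  where
  _≈?_ : (p q : Fin 5 × Fin 5) → _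
  p ≈? q = ≡-dec Fin._≟_ Fin._≟_ p q ⊎-dec ≡-dec Fin._≟_ Fin._≟_ p (swap q)

injective⇒irrelevant-fibres : {f : A → B} → Injective _≡_ _≡_ f → Irrelevant (λ y → ∃[ x ] f x ≡ y)
injective⇒irrelevant-fibres f-inj (x , refl) (x′ , fx′≡fx) with refl ← f-inj fx′≡fx with refl ← fx′≡fx = refl

module _ {K : Graph 0ℓ 0ℓ} (K-simple : Simple K) {Γ : Graph ν ℓ}
  {g : V K → V Γ} (g-inj : Injective _≡_ _≡_ g)
  (h : E K → E Γ) (h-ends : ∀ j → ends Γ (h j) ≈ₑ map× g g (ends K j)) where

  -- The orientation is an explicit argument, later `h-ends j`, so that matching on it makes the
  -- chosen preimages compute.
  closed-image : ∀ j → ends Γ (h j) ≈ₑ map× g g (ends K j) →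
    (∃[ i ] g i ≡ proj₁ (ends Γ (h j))) × (∃[ i ] g i ≡ proj₂ (ends Γ (h j)))
  closed-image j (inj₁ eq) = (_ , sym (cong proj₁ eq)) , (_ , sym (cong proj₂ eq))
  closed-image j (inj₂ eq) = (_ , sym (cong proj₁ eq)) , (_ , sym (cong proj₂ eq))

  closed-image-ends : ∀ j eq → ends K j ≈ₑ map× proj₁ proj₁ (closed-image j eq)
  closed-image-ends j (inj₁ eq) = inj₁ refl
  closed-image-ends j (inj₂ eq) = inj₂ refl

  -- With fibres as membership predicates, the isomorphism to `K` is a projection, and irrelevance
  -- is injectivity of `g` and `h`.
  image : Subgraph Γ
  image = record
    { InV            = λ x → ∃[ i ] g i ≡ x
    ; InE            = λ f → ∃[ j ] h j ≡ f
    ; InV-irrelevant = injective⇒irrelevant-fibres g-inj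
    ; InE-irrelevant = injective⇒irrelevant-fibres h-inj
    ; closed         = λ { (j , refl) → closed-image j (h-ends j) }
    }
    where
    h-inj : Injective _≡_ _≡_ h
    h-inj {i} {j} hi≡hj = K-simple i j (pull (≈ₑ-trans (≈ₑ-sym (h-ends i))
      (subst (λ f → ends Γ f ≈ₑ map× g g (ends K j)) (sym hi≡hj) (h-ends j))))
      where
      pull : ∀ {p q} → map× g g p ≈ₑ map× g g q → p ≈ₑ q
      pull (inj₁ eq) = inj₁ (cong₂ _,_ (g-inj (cong proj₁ eq)) (g-inj (cong proj₂ eq)))
      pull (inj₂ eq) = inj₂ (cong₂ _,_ (g-inj (cong proj₁ eq)) (g-inj (cong proj₂ eq)))

  image≅ : ⟦ image ⟧ ≅ K
  image≅ = record
    { onV = mk↔ₛ′ (proj₁ ∘ proj₂) (λ i → g i , i , refl) (λ _ → refl) λ { (_ , _ , refl) → refl }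
    ; onE = mk↔ₛ′ (proj₁ ∘ proj₂) (λ j → h j , j , refl) (λ _ → refl) λ { (_ , _ , refl) → refl }
    ; preserves-ends = λ { (_ , j , refl) → closed-image-ends j (h-ends j) }
    }

module _ {K : Graph ν′ ℓ′} {Γ : Graph ν ℓ} (S : Subgraph Γ) (ψ : ⟦ S ⟧ ≅ K) where
  private
    module ψV = Inverse (_≅_.onV ψ)
    module ψE = Inverse (_≅_.onE ψ)

  copy-vertex : V K → V Γ
  copy-vertex = proj₁ ∘ ψV.from

  copy-vertex∈ : ∀ i → InV S (copy-vertex i)
  copy-vertex∈ = proj₂ ∘ ψV.from

  copy-vertex-injective : Injective _≡_ _≡_ copy-vertex
  copy-vertex-injective = Injection.injective (↔⇒↣ (↔-sym (_≅_.onV ψ))) ∘ ext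
    where
    ext : ∀ {p q : Σ (V Γ) (InV S)} → proj₁ p ≡ proj₁ q → p ≡ q
    ext {x , p} {_ , q} refl = cong (x ,_) (InV-irrelevant S p q)

  copy-adjacent : ∀ j → Adjacent Γ (copy-vertex (proj₁ (ends K j))) (copy-vertex (proj₂ (ends K j)))
  copy-adjacent j = proj₁ f , ≈ₑ-sym (≈ₑ-map proj₁ (≈ₑ-trans (≈ₑ-map ψV.from endsK)
      (inj₁ (cong₂ _,_ (ψV.strictlyInverseʳ _) (ψV.strictlyInverseʳ _)))))
    where
    f = ψE.from j
    endsK : ends K j ≈ₑ map× ψV.to ψV.to (ends ⟦ S ⟧ f)
    endsK = subst (λ i → ends K i ≈ₑ map× ψV.to ψV.to (ends ⟦ S ⟧ f)) (ψE.strictlyInverseˡ j)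
      (_≅_.preserves-ends ψ f)

-- Forks in the underlying simple graph.

module Simplification {Γ : Graph ν ℓ} (em : ExcludedMiddle (ν ⊔ ℓ)) (vt : VertexTransitive Γ) where

  -- Parallel edges are merged and loops dropped; copies of `D₅` use no loops, so they survive as
  -- forks.
  _~_ : V Γ → V Γ → Set (ν ⊔ ℓ)
  x ~ y = Adjacent Γ x y × x ≢ y

  ~-sym : ∀ {x y} → x ~ y → y ~ x
  ~-sym ((f , f-ends) , x≢y) = (f , ≈ₑ-trans f-ends (inj₂ refl)) , ≢-sym x≢y

  ~-irrefl : ∀ {x} → ¬ x ~ x
  ~-irrefl (_ , x≢x) = x≢x refl

  homogeneous : Homogeneous _~_
  homogeneous x y with φ , φx≡y ← vt x y = applyV , applyV-injective , applyV-~ , φx≡y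
    where
    open _≅_ φ
    applyV-injective : Injective _≡_ _≡_ applyV
    applyV-injective = Injection.injective (↔⇒↣ onV)
    applyV-~ : ∀ {p q} → p ~ q → applyV p ~ applyV q
    applyV-~ ((f , f-ends) , p≢q) =
      (applyE f , ≈ₑ-trans (preserves-ends f) (≈ₑ-map applyV f-ends)) , p≢q ∘ applyV-injective

  open HomogeneousGraph _~_ ~-sym ~-irrefl em homogeneous public

  connected-~ : Connected Γ → ∀ x y → Star _~_ x y
  connected-~ conn x y = drop-loops (conn x y)
    where
    drop-loops : ∀ {x y} → Star (Adjacent Γ) x y → Star _~_ x y
    drop-loops ε = ε
    drop-loops {x} (_◅_ {j = z} x~z rest) with x ≟ z
    ... | yes refl = drop-loops rest
    ... | no  x≢z  = (x~z , x≢z) ◅ drop-loops rest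

  copy⇒fork : (S : Subgraph Γ) (ψ : ⟦ S ⟧ ≅ D₅) → Fork (tabulate (copy-vertex S ψ))
  copy⇒fork S ψ = fork (tabulate⁺ (copy-vertex-injective S ψ))
    (edge 0F λ ()) (edge 1F λ ()) (edge 2F λ ()) (edge 3F λ ())
    where
    edge : ∀ j → proj₁ (ends D₅ j) ≢ proj₂ (ends D₅ j) →
           copy-vertex S ψ (proj₁ (ends D₅ j)) ~ copy-vertex S ψ (proj₂ (ends D₅ j))
    edge j i≢i′ = copy-adjacent S ψ j , i≢i′ ∘ copy-vertex-injective S ψ

  -- Each adjacency carries a particular edge of `Γ`; these four edges select one copy among those
  -- that parallel edges may offer.
  fork⇒copy : ∀ {t} → Fork t → Σ[ S ∈ Subgraph Γ ] ⟦ S ⟧ ≅ D₅ × (∀ {x} → InV S x → x ∈ t)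
  fork⇒copy (fork {v} {a} {b} {c} {d} t! (va , _) (vb , _) (vc , _) (cd , _)) =
    image D₅-simple (lookup-injective t!) h h-ends , image≅ D₅-simple (lookup-injective t!) h h-ends ,
    λ { (i , refl) → ∈-lookup i }
    where
    h : Fin 4 → E Γ
    h 0F = proj₁ va
    h 1F = proj₁ vb
    h 2F = proj₁ vc
    h 3F = proj₁ cd
    g = lookup (v ∷ a ∷ b ∷ c ∷ d ∷ [])
    h-ends : ∀ j → ends Γ (h j) ≈ₑ map× g g (ends D₅ j)
    h-ends 0F = proj₂ va
    h-ends 1F = proj₂ vb
    h-ends 2F = proj₂ vc
    h-ends 3F = proj₂ cd

  meets⇒hit : ∀ {X} → Meets Γ D₅ X → ∀ {t} → Fork t → Any (_∈ X) t
  meets⇒hit meets F = let S , ψ , InV⇒∈ = fork⇒copy F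
                          x , x∈X , x∈S = meets S ψ
                      in lose (InV⇒∈ x∈S) x∈X

-- The strict inequality and the failure of costliness.

D₅-Υˢʸᵐ<5Υ : ∀ {v e : Level} → ExcludedMiddle (v ⊔ e) →
  (Γ : Graph v e) → VertexTransitive Γ → Connected Γ →
  HasMoreVerticesThan 5 Γ → Contains Γ D₅ →
  (n : ℕ) → Υᵥ[ D₅ , Γ ]≡ n →
  ∃[ s ] Υᵥˢʸᵐ[ D₅ , Γ ]≡ s × s < 5 * n
D₅-Υˢʸᵐ<5Υ em Γ vt conn (Y , Y! , 5<|Y|) (S , ψ) n ((X , X! , refl , meets) , _) =
  length U , ((U , U! , refl , all-meets , λ _ _ → ∈U _) , U-minimal) , length-U< (connected-~ conn) Y! 5<|Y| U! ∈U
  where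
  open Simplification em vt
  open Transversal (meets⇒hit meets) (copy⇒fork S ψ)
  U  = proj₁ finite
  U! = proj₁ (proj₂ finite)
  ∈U = proj₂ (proj₂ finite)

  all-meets : Meets Γ D₅ U
  all-meets S ψ = _ , ∈U _ , copy-vertex∈ S ψ 0F

  -- A set meeting the copy `S` is non-empty, and invariance under a transitive group then puts
  -- every vertex into it.
  U-minimal : ∀ {m} → ∃[ X′ ] Unique X′ × length X′ ≡ m × Meets Γ D₅ X′ × AutInvariant Γ X′ →
    length U ≤ m
  U-minimal (X′ , _ , refl , meets′ , invariant) = unique-⊆⇒length-≤ U! λ {y} _ →
    let x , x∈X′ , _ = meets′ S ψ
        φ , φx≡y = vt x y
    in subst (_∈ X′) φx≡y (invariant φ x∈X′)

theorem2 : ∀ {v e : Level} → ExcludedMiddle (v ⊔ e) →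
    ((Γ : Graph v e) → VertexTransitive Γ → Connected Γ →
    HasMoreVerticesThan 5 Γ → Contains Γ D₅ →
    (n : ℕ) → Υᵥ[ D₅ , Γ ]≡ n →
    ∃[ s ] Υᵥˢʸᵐ[ D₅ , Γ ]≡ s × s < 5 * n)
    × ¬ VertexCostly D₅ D₅-finite (λ (Γ : Graph v e) → VertexTransitive Γ × Connected Γ)
theorem2 {v} {e} em = D₅-Υˢʸᵐ<5Υ em , not-costly
  where
  not-costly : ¬ VertexCostly D₅ D₅-finite (λ (Γ : Graph v e) → VertexTransitive Γ × Connected Γ)
  not-costly costly
    -- The choice of six makes the invariant set of size `s` itself a witness that `Γ` has more than
    -- five vertices.
    with Γ , (vt , conn) , s , n , ((X , X! , |X|≡s , _) , s-min) , Υ≡n , s≡5n , ℤ.+≤+ 6≤s ← costly (ℤ.+ 6)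
    with em {P = ∃[ t ] Simplification.Fork em vt t}
  -- Without forks the empty set is admissible, so `s` would be zero.
  ... | no no-fork = ≤⇒≯ (s-min ([] , [] , refl , (λ S ψ → contradiction (_ , copy⇒fork S ψ) no-fork) , λ _ ()))
                       (≤-trans (s≤s z≤n) 6≤s)
    where open Simplification em vt
  ... | yes (_ , F) =
    let S , ψ , _ = fork⇒copy F
        s′ , (sym-set , _) , s′<5n = D₅-Υˢʸᵐ<5Υ em Γ vt conn
          (X , X! , subst (5 <_) (sym |X|≡s) 6≤s) (S , ψ) n Υ≡n
    in ≤⇒≯ (s-min sym-set) (subst (s′ <_) (sym s≡5n) s′<5n)
    where open Simplification em vt
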